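{- For every integer $n\ge 1$, $\mathrm{pf}_n(123,132,213)$ is equal to the number of rooted ordered trees with $n+1$ edges such that every vertex is either a leaf or adjacent to a leaf.
   Context: A Dyck path of semilength $n$ is a lattice path from $(0,0)$ to $(n,n)$ consisting of $n$ north steps $N=(0,1)$ and $n$ east steps $E=(1,0)$ that never goes below the line $y=x$. A parking function of size $n$ is a Dyck path of semilength $n$ whose $n$ north steps are labeled bijectively by $\{1,\dots,n\}$ so that whenever two north steps are consecutive in the path (one immediately following the other), the label of the later one is larger. For a parking function $p$ of size $n$, $\phi(p)$ is the permutation of $\{1,\dots,n\}$ (in one-line notation) obtained by reading the labels of the north steps in the order they occur along the path. A permutation $\pi$ of $\{1,\dots,n\}$ contains a permutation $\rho$ of $\{1,\dots,m\}$ if there are indices $1\le i_1<\cdots<i_m\le n$ such that $\pi_{i_a}\le\pi_{i_b}$ if and only if $\rho_a\le\rho_b$; otherwise $\pi$ avoids $\rho$. For permutations $\rho_1,\dots,\rho_r$, $\mathrm{pf}_n(\rho_1,\dots,\rho_r)$ denotes the number of parking functions $p$ of size $n$ such that $\phi(p)$ avoids each of $\rho_1,\dots,\rho_r$. A rooted ordered tree is a finite unlabeled rooted tree in which the children of each vertex are linearly ordered (a plane tree). A leaf is a vertex with no children (so the root of a tree with at least one edge is never a leaf, even if it has degree one). Two vertices are adjacent if they are joined by an edge. -}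

module Defs where

open import Data.Fin.Base using (Fin)
import Data.Fin.Base as Fin
open import Data.List.Base using (List; []; _∷_; length; lookup; map; mapMaybe; take; upTo)
open import Data.List.Membership.Propositional using (_∈_)
open import Data.List.Relation.Binary.Permutation.Propositional using (_↭_)
open import Data.List.Relation.Unary.All using (All)
open import Data.List.Relation.Unary.Linked using (Linked)
open import Data.List.Relation.Unary.Unique.Propositional using (Unique)
open import Data.List.Membership.Propositional.Properties.WithK using (unique∧set⇒bag)
open import Data.List.Relation.Binary.BagAndSetEquality using (∼bag⇒↭)
open import Data.List.Relation.Binary.Permutation.Propositional.Properties using (↭-length)
open import Data.Maybe.Base using (Maybe; just; nothing)
open import Data.Nat.Base using (ℕ; suc; _+_; _≤_; _<_)
open import Data.Product.Base using (_×_; ∃-syntax; Σ-syntax)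
open import Data.Sum.Base using (_⊎_)
open import Data.Unit.Base using (⊤)
open import Function.Base using (_∘_)
open import Function.Bundles using (_⇔_; mk⇔)
open import Relation.Binary.PropositionalEquality using (_≡_; sym; trans)
open import Relation.Nullary.Negation using (¬_)

-- The number of elements satisfying P is k.  Proofs of P x play no role in
-- the count, so P need not be proof-irrelevant.
record HasCardinality {A : Set} (P : A → Set) (k : ℕ) : Set where
  field
    elements : List A
    unique   : Unique elements
    sound    : ∀ {x} → x ∈ elements → P x
    complete : ∀ {x} → P x → x ∈ elements
    size     : length elements ≡ k

cardinality-unique : ∀ {A : Set} {P : A → Set} {k l} →
                     HasCardinality P k → HasCardinality P l → k ≡ l
cardinality-unique p q =
  trans (sym (size p)) (trans (↭-length (∼bag⇒↭ same)) (size q))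
  where
  open HasCardinality
  same = unique∧set⇒bag (unique p) (unique q)
           (mk⇔ (complete q ∘ sound p) (complete p ∘ sound q))

data Step : Set where
  N E : Step

#N : List Step → ℕ
#N []      = 0
#N (N ∷ w) = suc (#N w)
#N (E ∷ w) = #N w

#E : List Step → ℕ
#E []      = 0
#E (N ∷ w) = #E w
#E (E ∷ w) = suc (#E w)

-- After its first i steps the path w is at the point
-- (#E (take i w) , #N (take i w)).
record IsDyckPath (n : ℕ) (w : List Step) : Set where
  field
    north-steps : #N w ≡ n
    east-steps  : #E w ≡ n
    never-below : ∀ i → #E (take i w) ≤ #N (take i w)

data LabelledStep : Set where
  N : (label : ℕ) → LabelledStep
  E : LabelledStep

forget : LabelledStep → Step
forget (N _) = N
forget E     = E

label? : LabelledStep → Maybe ℕ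
label? (N a) = just a
label? E     = nothing

φ : List LabelledStep → List ℕ
φ = mapMaybe label?

Increasing : LabelledStep → LabelledStep → Set
Increasing (N a) (N b) = a < b
Increasing (N _) E     = ⊤
Increasing E     _     = ⊤

-- One-line notation: each of 1, …, n occurs exactly once.
IsPermutation : ℕ → List ℕ → Set
IsPermutation n π = π ↭ map suc (upTo n)

record IsParkingFunction (n : ℕ) (p : List LabelledStep) : Set where
  field
    dyck       : IsDyckPath n (map forget p)
    bijective  : IsPermutation n (φ p)
    increasing : Linked Increasing p

_Contains_ : List ℕ → List ℕ → Set
π Contains ρ =
  Σ[ i ∈ (Fin (length ρ) → Fin (length π)) ]
         (∀ {a b} → a Fin.< b → i a Fin.< i b)
       × (∀ a b → (lookup π (i a) ≤ lookup π (i b)) ⇔ (lookup ρ a ≤ lookup ρ b))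

_Avoids_ : List ℕ → List ℕ → Set
π Avoids ρ = ¬ (π Contains ρ)

-- IsPf n ρs k says that pf_n(ρs) = k.
IsPf : ℕ → List (List ℕ) → ℕ → Set
IsPf n ρs =
  HasCardinality (λ p → IsParkingFunction n p × All (φ p Avoids_) ρs)

data Tree : Set where
  node : (children : List Tree) → Tree

mutual
  edges : Tree → ℕ
  edges (node ts) = edgesToAndWithin ts

  edgesToAndWithin : List Tree → ℕ
  edgesToAndWithin []       = 0
  edgesToAndWithin (t ∷ ts) = suc (edges t) + edgesToAndWithin ts

data Vertex : Tree → Set where
  root  : ∀ {t} → Vertex t
  below : ∀ {ts} (i : Fin (length ts)) → Vertex (lookup ts i) → Vertex (node ts)

data _IsParentOf_ : ∀ {t} → Vertex t → Vertex t → Set where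
  at-root : ∀ {ts} (i : Fin (length ts)) →
            _IsParentOf_ {node ts} root (below i root)
  below   : ∀ {ts} (i : Fin (length ts)) {u v : Vertex (lookup ts i)} →
            u IsParentOf v → _IsParentOf_ {node ts} (below i u) (below i v)

Adjacent : ∀ {t} → Vertex t → Vertex t → Set
Adjacent u v = (u IsParentOf v) ⊎ (v IsParentOf u)

IsLeaf : ∀ {t} → Vertex t → Set
IsLeaf v = ∀ u → ¬ (v IsParentOf u)

EveryVertexLeafOrAdjacentToLeaf : Tree → Set
EveryVertexLeafOrAdjacentToLeaf t =
  ∀ (v : Vertex t) → IsLeaf v ⊎ (∃[ u ] Adjacent v u × IsLeaf u)

module Submission where

open import Defs
open import Data.Empty using (⊥-elim)
open import Data.Fin.Base as Fin using (Fin; zero; suc)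
open import Data.List.Base using (List; []; _∷_; _++_; downFrom; length; lookup; map; take; upTo)
open import Data.List.Membership.Propositional using (_∈_)
open import Data.List.Membership.Propositional.Properties
  using (∈-map⁺; ∈-map⁻; ∈-++⁺ˡ; ∈-++⁺ʳ; ∈-++⁻; ∈-lookup; ∈-downFrom⁻)
open import Data.List.Properties
  using (length-map; ∷-injectiveˡ; ∷-injectiveʳ; reverse-downFrom)
open import Data.List.Relation.Binary.Disjoint.Propositional using (Disjoint)
open import Data.List.Relation.Binary.Permutation.Propositional
  using (_↭_; ↭-refl; ↭-sym; ↭-trans; prep; swap; ↭⇒↭ₛ)
open import Data.List.Relation.Binary.Permutation.Propositional.Properties
  using (∈-resp-↭; drop-∷; ↭-reverse; ↭-empty-inv) renaming (map⁺ to ↭-map⁺)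
import Data.List.Relation.Binary.Permutation.Setoid.Properties as Setoid↭
open import Data.List.Relation.Unary.All as All using (All; []; _∷_)
open import Data.List.Relation.Unary.Any as Any using (here; there)
open import Data.List.Relation.Unary.Any.Properties using (lookup-index)
open import Data.List.Relation.Unary.Linked as Linked using (Linked; []; [-]; _∷_)
open import Data.List.Relation.Unary.Unique.Propositional using (Unique; []; _∷_)
import Data.List.Relation.Unary.Unique.Propositional.Properties as Unique
open import Data.Nat.Base using (ℕ; zero; suc; _+_; _≤_; _<_; _≥_; z≤n; s≤s; z<s; s<s)
open import Data.Nat.Properties
open import Data.Nat.Tactic.RingSolver using (solve-∀)
open import Data.Product.Base using (Σ; _×_; _,_; ∃-syntax; Σ-syntax; proj₁; proj₂)
  renaming (swap to ×-swap)
open import Data.Sum.Base using (_⊎_; inj₁; inj₂)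
open import Data.Unit.Base using (tt)
open import Data.Vec.Base using (Vec; []; _∷_)
open import Function.Base using (_∘_; id)
open import Function.Bundles using (_⇔_; mk⇔; Equivalence)
open import Relation.Binary.Definitions using (tri<; tri≈; tri>)
open import Relation.Binary.PropositionalEquality
  using (_≡_; _≢_; refl; sym; trans; cong; subst; setoid; module ≡-Reasoning)
open import Relation.Nullary.Negation using (¬_; contradiction)

-- A permutation avoids 123, 132 and 213 exactly when π i > π k for all k ≥ i + 2,
-- that is, when it is a decreasing sequence of layers m and (m-1) m.  A run of north
-- steps then has length at most two, so, up to its labels, a parking function is a word
-- in the letters N E, E and N, the last of which opens a layer of size two that the
-- next N E completes.  Read by a stack machine, the same words build exactly once each
-- plane tree in which every internal vertex has a leaf child: N starts a new vertex,
-- N E gives the current vertex a leaf, and E attaches to it a completed vertex.  The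
-- machine starts at a vertex with one leaf, which is the additional edge of the tree.

-- Transport of a count along a bijection.

transfer : ∀ {A B : Set} {P : A → Set} {Q : B → Set} {k} (f : A → B) →
           (∀ {x y} → f x ≡ f y → x ≡ y) →
           (∀ {x} → P x → Q (f x)) →
           (∀ {y} → Q y → ∃[ x ] P x × f x ≡ y) →
           HasCardinality P k → HasCardinality Q k
transfer {Q = Q} f injective preserves covers c = record
  { elements = map f elements
  ; unique   = Unique.map⁺ injective unique
  ; sound    = λ y∈ → let _ , x∈ , eq = ∈-map⁻ f y∈ in
                      subst Q (sym eq) (preserves (sound x∈))
  ; complete = λ q → let _ , p , eq = covers q in
                     subst (_∈ map f elements) eq (∈-map⁺ f (complete p))
  ; size     = trans (length-map f elements) size
  }
  where open HasCardinality c

-- Words and their enumeration by weight.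

data Status : Set where
  pending ready : Status

-- A word is read along a Dyck path whose labels are read off a layered permutation:
-- level is N E, down is E, and up is an N carrying the smaller label of an ascent.
-- The larger label of that ascent is carried by the next level, and the word is
-- pending until then.  The index ℕ is the height at which the word starts.
data Word : Status → ℕ → Set where
  end   : Word ready 0
  level : ∀ {s h} → Word ready h → Word s h
  down  : ∀ {s h} → Word s h → Word s (suc h)
  up    : ∀ {h} → Word pending (suc h) → Word ready h

weight : ∀ {s h} → Word s h → ℕ
weight end       = 0
weight (level w) = suc (weight w)
weight (down w)  = weight w
weight (up w)    = suc (weight w)

mutual
  -- The words are sorted by first letter. The recursion is lexicographic: `level` and `up` lower
  -- the weight, while `down` keeps it and lowers the height.
  words : ∀ s h (n : ℕ) → List (Word s h)
  words s h n = ends s h n ++ levels s h n ++ downs s h n ++ ups s h n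

  ends : ∀ s h (n : ℕ) → List (Word s h)
  ends ready zero zero = end ∷ []
  ends _     _    _    = []

  levels : ∀ s h (n : ℕ) → List (Word s h)
  levels s h zero    = []
  levels s h (suc n) = map level (words ready h n)

  downs : ∀ s h (n : ℕ) → List (Word s h)
  downs s zero    n = []
  downs s (suc h) n = map down (words s h n)

  ups : ∀ s h (n : ℕ) → List (Word s h)
  ups ready h (suc n) = map up (words pending (suc h) n)
  ups _     _ _       = []

-- The four first-letter predicates serve to show that the four parts of `words` are pairwise
-- disjoint.
data IsEnd : ∀ {s h} → Word s h → Set where
  end : IsEnd end

data IsLevel : ∀ {s h} → Word s h → Set where
  level : ∀ {s h} (w : Word ready h) → IsLevel {s} (level w)

data IsDown : ∀ {s h} → Word s h → Set where
  down : ∀ {s h} (w : Word s h) → IsDown (down w)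

data IsUp : ∀ {s h} → Word s h → Set where
  up : ∀ {h} (w : Word pending (suc h)) → IsUp (up w)

∈ends : ∀ s h (n : ℕ) {w} → w ∈ ends s h n → IsEnd w
∈ends ready zero zero (here refl) = end

∈levels : ∀ s h (n : ℕ) {w} → w ∈ levels s h n → IsLevel w
∈levels s h (suc n) w∈ with _ , _ , refl ← ∈-map⁻ level w∈ = level _

∈downs : ∀ s h (n : ℕ) {w} → w ∈ downs s h n → IsDown w
∈downs s (suc h) n w∈ with _ , _ , refl ← ∈-map⁻ down w∈ = down _

∈ups : ∀ s h (n : ℕ) {w} → w ∈ ups s h n → IsUp w
∈ups ready h (suc n) w∈ with _ , _ , refl ← ∈-map⁻ up w∈ = up _

mutual
  words-unique : ∀ s h (n : ℕ) → Unique (words s h n)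
  words-unique s h n =
    Unique.++⁺ (ends-unique s h n)
      (Unique.++⁺ (levels-unique s h n)
        (Unique.++⁺ (downs-unique s h n) (ups-unique s h n) down#up)
        level#)
      end#
    where
    down#up : Disjoint (downs s h n) (ups s h n)
    down#up (p , q) with ∈downs s h n p | ∈ups s h n q
    ... | down _ | ()

    level# : Disjoint (levels s h n) (downs s h n ++ ups s h n)
    level# (p , q) with ∈levels s h n p | ∈-++⁻ (downs s h n) q
    ... | level _ | inj₁ r with () ← ∈downs s h n r
    ... | level _ | inj₂ r with () ← ∈ups s h n r

    end# : Disjoint (ends s h n) (levels s h n ++ downs s h n ++ ups s h n)
    end# (p , q) with ∈ends s h n p | ∈-++⁻ (levels s h n) q
    ... | end | inj₁ r with () ← ∈levels s h n r
    ... | end | inj₂ r with ∈-++⁻ (downs s h n) r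
    ...   | inj₁ r′ with () ← ∈downs s h n r′
    ...   | inj₂ r′ with () ← ∈ups s h n r′

  ends-unique : ∀ s h (n : ℕ) → Unique (ends s h n)
  ends-unique ready   zero    zero    = [] ∷ []
  ends-unique ready   zero    (suc n) = []
  ends-unique ready   (suc h) n       = []
  ends-unique pending h       n       = []

  levels-unique : ∀ s h (n : ℕ) → Unique (levels s h n)
  levels-unique s h zero    = []
  levels-unique s h (suc n) =
    Unique.map⁺ (λ { refl → refl }) (words-unique ready h n)

  downs-unique : ∀ s h (n : ℕ) → Unique (downs s h n)
  downs-unique s zero    n = []
  downs-unique s (suc h) n =
    Unique.map⁺ (λ { refl → refl }) (words-unique s h n)

  ups-unique : ∀ s h (n : ℕ) → Unique (ups s h n)
  ups-unique pending h n       = []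
  ups-unique ready   h zero    = []
  ups-unique ready   h (suc n) =
    Unique.map⁺ (λ { refl → refl }) (words-unique pending (suc h) n)

words-sound : ∀ s h (n : ℕ) {w} → w ∈ words s h n → weight w ≡ n
words-sound s h n w∈ with ∈-++⁻ (ends s h n) w∈
words-sound ready zero zero _ | inj₁ (here refl) = refl
... | inj₂ w∈′ with ∈-++⁻ (levels s h n) w∈′
words-sound s h (suc n) _ | inj₂ _ | inj₁ p with _ , v∈ , refl ← ∈-map⁻ level p =
  cong suc (words-sound ready h n v∈)
... | inj₂ w∈″ with ∈-++⁻ (downs s h n) w∈″
words-sound s (suc h) n _ | inj₂ _ | inj₂ _ | inj₁ p with _ , v∈ , refl ← ∈-map⁻ down p =
  words-sound s h n v∈
words-sound ready h (suc n) _ | inj₂ _ | inj₂ _ | inj₂ p with _ , v∈ , refl ← ∈-map⁻ up p =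
  cong suc (words-sound pending (suc h) n v∈)

words-complete : ∀ {s h} (w : Word s h) → w ∈ words s h (weight w)
words-complete end = here refl
words-complete {s} {h} v@(level w) =
  ∈-++⁺ʳ (ends s h (weight v))
    (∈-++⁺ˡ (∈-map⁺ level (words-complete w)))
words-complete {s} {h} v@(down w) =
  ∈-++⁺ʳ (ends s h (weight v))
    (∈-++⁺ʳ (levels s h (weight v))
      (∈-++⁺ˡ (∈-map⁺ down (words-complete w))))
words-complete {s} {h} v@(up w) =
  ∈-++⁺ʳ (ends s h (weight v))
    (∈-++⁺ʳ (levels s h (weight v))
      (∈-++⁺ʳ (downs s h (weight v)) (∈-map⁺ up (words-complete w))))

words-cardinality : ∀ s h (n : ℕ) →
  HasCardinality {Word s h} (λ w → weight w ≡ n) (length (words s h n))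
words-cardinality s h n = record
  { elements = words s h n
  ; unique   = words-unique s h n
  ; sound    = words-sound s h n
  ; complete = λ { refl → words-complete _ }
  ; size     = refl
  }

-- The stack machine and its inverse.

-- The children of a vertex, last one first: leaf∷ adds a leaf, and every other child
-- must itself have a leaf child.  The status is ready once there is a leaf.
data Forest : Status → Set where
  []    : Forest pending
  leaf∷ : ∀ {s} → Forest s → Forest ready
  _∷_   : ∀ {s} → Forest ready → Forest s → Forest s

Stack : ℕ → Set
Stack = Vec (Forest ready)

-- A stack machine: up suspends the current vertex on the stack and starts a new one,
-- level gives the current vertex a leaf, and down attaches to it the top of the stack.
decode : ∀ {s h} → Word s h → Forest s → Stack h → Forest ready
decode end       f []       = f
decode (level w) f ts       = decode w (leaf∷ f) ts
decode (down w)  f (t ∷ ts) = decode w (t ∷ f) ts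
decode (up w)    f ts       = decode w [] (f ∷ ts)

-- Runs the machine backwards, with the stack represented by the continuation k so that
-- the recursion is structural in the forest.
encode : ∀ {s h} → Forest s → (Word pending h → Word pending 0) →
         Word s h → Word pending 0
encode []        k w = k w
encode (leaf∷ f) k w = encode f k (level w)
encode (t ∷ f)   k w = encode f (λ v → encode t k (up v)) (down w)

encodeStack : ∀ {h} → Stack h → Word pending h → Word pending 0
encodeStack []       w = w
encodeStack (t ∷ ts) w = encode t (encodeStack ts) (up w)

-- The right side is the word that builds the configuration `f`, `ts` and then continues with `w`. A
-- machine step only moves a letter from `w` into the configuration, so this word is invariant.
encode∘decode : ∀ {s h} (w : Word s h) f ts →
                encode (decode w f ts) id end ≡ encode f (encodeStack ts) w
encode∘decode end       f []       = refl
encode∘decode (level w) f ts       = encode∘decode w (leaf∷ f) ts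
encode∘decode (down w)  f (t ∷ ts) = encode∘decode w (t ∷ f) ts
encode∘decode (up w)    f ts       = encode∘decode w [] (f ∷ ts)

-- By hypothesis, `k v` run from an empty vertex and empty stack acts like `v` run from an empty
-- vertex over `ts`. For a child `t` the stack becomes `t ∷ ts`, and the induction for `t` gives the
-- hypothesis for the new continuation.
decode∘encode : ∀ {s h} (f : Forest s) k ts →
                (∀ v → decode (k v) [] [] ≡ decode v [] ts) →
                (w : Word s h) → decode (encode f k w) [] [] ≡ decode w f ts
decode∘encode []        k ts hyp w = hyp w
decode∘encode (leaf∷ f) k ts hyp w = decode∘encode f k ts hyp (level w)
decode∘encode (t ∷ f)   k ts hyp w =
  decode∘encode f _ (t ∷ ts) (λ v → decode∘encode t k ts hyp (up v)) (down w)

toForest : Word ready 0 → Forest ready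
toForest w = decode w (leaf∷ []) []

toForest-injective : ∀ {v w} → toForest v ≡ toForest w → v ≡ w
-- The initial leaf is encoded as a leading `level`, which is stripped at the end.
toForest-injective {v} {w} eq = level-injective (begin
  level v                     ≡⟨ encode∘decode v (leaf∷ []) [] ⟨
  encode (toForest v) id end  ≡⟨ cong (λ f → encode f id end) eq ⟩
  encode (toForest w) id end  ≡⟨ encode∘decode w (leaf∷ []) [] ⟩
  level w                     ∎)
  where
  open ≡-Reasoning
  level-injective : ∀ {v w} → level {pending} {0} v ≡ level w → v ≡ w
  level-injective refl = refl

toForest-surjective : ∀ f → ∃[ w ] toForest w ≡ f
toForest-surjective f
  with encode f id end | decode∘encode f id [] (λ _ → refl) end
-- At height 0 and pending, no other letter can come first; this `level` is the initial leaf.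
... | level w | eq = w , eq

-- Forests as plane trees, and their edges.

trees : ∀ {s} → Forest s → List Tree
trees []        = []
trees (leaf∷ f) = node [] ∷ trees f
trees (t ∷ f)   = node (trees t) ∷ trees f

trees-nonempty : (f : Forest ready) → trees f ≢ []
trees-nonempty (leaf∷ f) ()
trees-nonempty (t ∷ f)   ()

node-injective : ∀ {ts us} → node ts ≡ node us → ts ≡ us
node-injective refl = refl

-- The two statuses vary separately because `leaf∷` hides the status of its tail. A leaf differs
-- from any other child since a ready forest is nonempty.
trees-injective-Σ : ∀ {s s′} (f : Forest s) (g : Forest s′) → trees f ≡ trees g →
                    _≡_ {A = Σ Status Forest} (s , f) (s′ , g)
trees-injective-Σ []        []        eq = refl
trees-injective-Σ (leaf∷ f) (leaf∷ g) eq
  with refl ← trees-injective-Σ f g (∷-injectiveʳ eq) = refl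
trees-injective-Σ (leaf∷ f) (t ∷ g)   eq =
  ⊥-elim (trees-nonempty t (sym (node-injective (∷-injectiveˡ eq))))
trees-injective-Σ (t ∷ f)   (leaf∷ g) eq =
  ⊥-elim (trees-nonempty t (node-injective (∷-injectiveˡ eq)))
trees-injective-Σ (t ∷ f)   (u ∷ g)   eq
  with refl ← trees-injective-Σ t u (node-injective (∷-injectiveˡ eq))
     | refl ← trees-injective-Σ f g (∷-injectiveʳ eq) = refl
trees-injective-Σ []        (leaf∷ g) ()
trees-injective-Σ []        (t ∷ g)   ()
trees-injective-Σ (leaf∷ f) []        ()
trees-injective-Σ (t ∷ f)   []        ()

trees-injective : ∀ {s} {f g : Forest s} → trees f ≡ trees g → f ≡ g
trees-injective {f = f} {g} eq with refl ← trees-injective-Σ f g eq = refl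

-- The `suc` counts in advance the edge by which `down` will attach the suspended vertex. So `up`
-- pays for that edge and `down` is free, in agreement with `weight`.
stackEdges : ∀ {h} → Stack h → ℕ
stackEdges []       = 0
stackEdges (t ∷ ts) = suc (edgesToAndWithin (trees t)) + stackEdges ts

edges-decode : ∀ {s h} (w : Word s h) f ts →
               edgesToAndWithin (trees (decode w f ts)) ≡
               weight w + edgesToAndWithin (trees f) + stackEdges ts
edges-decode end       f []       = sym (+-identityʳ _)
edges-decode (level w) f ts       =
  trans (edges-decode w (leaf∷ f) ts) (cong (_+ stackEdges ts) (+-suc _ _))
edges-decode (down w)  f (t ∷ ts) =
  trans (edges-decode w (t ∷ f) ts) (regroup (weight w) _ _ _)
  where
  regroup : ∀ w t f s → w + suc (t + f) + s ≡ w + f + suc (t + s)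
  regroup = solve-∀
edges-decode (up w)    f ts       =
  trans (edges-decode w [] (f ∷ ts)) (regroup (weight w) _ _)
  where
  regroup : ∀ w f s → w + 0 + suc (f + s) ≡ suc (w + f + s)
  regroup = solve-∀

-- Trees in which every vertex is a leaf or adjacent to one.

Good : Tree → Set
Good = EveryVertexLeafOrAdjacentToLeaf

-- A leaf next to a vertex of the subtree lies in the subtree: the only possible neighbour outside
-- is the root, which has a child.
lookup-below : ∀ {ts} i → Good (node ts) → Good (lookup ts i)
lookup-below i good v with good (below i v)
... | inj₁ leaf = inj₁ λ u v→u → leaf (below i u) (below i v→u)
... | inj₂ (_ , inj₁ (below .i {v = u} v→u) , leaf) =
  inj₂ (u , inj₁ v→u , λ x u→x → leaf (below i x) (below i u→x))
... | inj₂ (_ , inj₂ (at-root .i) , leaf) = ⊥-elim (leaf _ (at-root i))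
... | inj₂ (_ , inj₂ (below .i {u = u} u→v) , leaf) =
  inj₂ (u , inj₂ u→v , λ x u→x → leaf (below i x) (below i u→x))

no-leaf-child : ∀ {ts} → (∀ i → lookup ts i ≢ node []) →
             (i : Fin (length ts)) → ¬ Good (node ts)
no-leaf-child nonleaf i good with good root
... | inj₁ leaf = leaf _ (at-root i)
... | inj₂ (_ , inj₁ (at-root j) , leaf) = nonleaf j (childless (λ u e → leaf _ (below j e)))
  where
  childless : ∀ {t} → IsLeaf {t} root → t ≡ node []
  childless {node []}       _    = refl
  childless {node (_ ∷ _)} leaf = ⊥-elim (leaf _ (at-root zero))

pending-nonleaf : (f : Forest pending) → ∀ i → lookup (trees f) i ≢ node []
pending-nonleaf (t ∷ f) zero    eq = trees-nonempty t (node-injective eq)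
pending-nonleaf (t ∷ f) (suc i) eq = pending-nonleaf f i eq

mutual
  -- A child that is not a leaf has no leaf as a parent, so its leaf neighbour is one of its own
  -- children. Its forest is therefore ready, the pending case being refuted by `no-leaf-child`.
  forest : ∀ ts → (∀ i → Good (lookup ts i)) →
           ∃[ s ] Σ[ f ∈ Forest s ] trees f ≡ ts
  forest []                       good = pending , [] , refl
  forest (node [] ∷ ts)           good with forest ts (good ∘ suc)
  ... | _ , f , refl = ready , leaf∷ f , refl
  forest (node us@(_ ∷ _) ∷ ts) good
    with readyForest us zero (good zero) | forest ts (good ∘ suc)
  ... | t , eq | s , f , refl = s , t ∷ f , cong (λ us → node us ∷ trees f) eq

  readyForest : ∀ ts → Fin (length ts) → Good (node ts) →
                Σ[ f ∈ Forest ready ] trees f ≡ ts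
  readyForest ts i good with forest ts (λ j → lookup-below j good)
  ... | ready   , f , eq   = f , eq
  ... | pending , f , refl = ⊥-elim (no-leaf-child (pending-nonleaf f) i good)

ready-leaf : (f : Forest ready) → ∃[ i ] lookup (trees f) i ≡ node []
ready-leaf (leaf∷ f) = zero , refl
ready-leaf (t ∷ f)   with i , eq ← ready-leaf f = suc i , eq

childless-leaf : ∀ {t} → t ≡ node [] → IsLeaf {t} root
childless-leaf refl _ (at-root ())

lift-good : ∀ {ts} i {v : Vertex (lookup ts i)} →
  IsLeaf v ⊎ (∃[ u ] Adjacent v u × IsLeaf u) →
  IsLeaf (below {ts} i v) ⊎ (∃[ u ] Adjacent (below {ts} i v) u × IsLeaf u)
lift-good {ts} i = λ
  { (inj₁ leaf)                → inj₁ (lift-leaf leaf)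
  ; (inj₂ (u , inj₁ e , leaf)) → inj₂ (below i u , inj₁ (below i e) , lift-leaf leaf)
  ; (inj₂ (u , inj₂ e , leaf)) → inj₂ (below i u , inj₂ (below i e) , lift-leaf leaf) }
  where
  lift-leaf : ∀ {v : Vertex (lookup ts i)} → IsLeaf v → IsLeaf (below {ts} i v)
  lift-leaf leaf _ (below .i e) = leaf _ e

mutual
  children-good : ∀ {s} (f : Forest s) i → Good (lookup (trees f) i)
  children-good (leaf∷ f) zero    root = inj₁ (childless-leaf refl)
  children-good (leaf∷ f) (suc i) v    = children-good f i v
  children-good (t ∷ f)   zero    v    = ready-good t v
  children-good (t ∷ f)   (suc i) v    = children-good f i v

  ready-good : (f : Forest ready) → Good (node (trees f))
  ready-good f root with i , eq ← ready-leaf f =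
    inj₂ (below i root , inj₁ (at-root i) , λ { _ (below .i e) → childless-leaf eq _ e })
  ready-good f (below i v) = lift-good i (children-good f i v)

theTree : Word ready 0 → Tree
theTree w = node (trees (toForest w))

first-child : ∀ ts {m} → edgesToAndWithin ts ≡ suc m → Fin (length ts)
first-child (_ ∷ _) _ = zero

edges-theTree : ∀ w → edges (theTree w) ≡ weight w + 1
edges-theTree w = trans (edges-decode w _ _) (+-identityʳ _)

trees-cardinality : ∀ n → HasCardinality
  (λ t → (edges t ≡ n + 1) × EveryVertexLeafOrAdjacentToLeaf t)
  (length (words ready 0 n))
trees-cardinality n = transfer theTree
  (toForest-injective ∘ trees-injective ∘ node-injective)
  (λ { {w} refl → edges-theTree w , ready-good (toForest w) })
  covers
  (words-cardinality ready 0 n)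
  where
  covers : ∀ {t} → (edges t ≡ n + 1) × EveryVertexLeafOrAdjacentToLeaf t →
           ∃[ w ] weight w ≡ n × theTree w ≡ t
  covers {node ts} (eq , good)
    -- Having `n + 1` edges gives the root a child. This excludes the one-vertex tree, which
    -- satisfies the leaf condition but comes from no ready forest.
    with f , refl ← readyForest ts (first-child ts (trans eq (+-comm n 1))) good
    with w , refl ← toForest-surjective f =
    w , +-cancelʳ-≡ 1 _ _ (trans (sym (edges-theTree w)) eq) , refl

-- Layered permutations and pattern avoidance.

-- Layered pending m describes what is left of a layered permutation of 1, …, m + 1
-- after its first entry m.
data Layered : Status → ℕ → List ℕ → Set where
  []     : Layered ready 0 []
  single : ∀ {m π} → Layered ready m π → Layered ready (suc m) (suc m ∷ π)
  lower  : ∀ {m π} → Layered pending m π → Layered ready (suc m) (m ∷ π)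
  upper  : ∀ {m π} → Layered ready m π → Layered pending (suc m) (suc (suc m) ∷ π)

-- In decreasing order, since layers use up the values from the top: a layer of size one matches the
-- head, one of size two the first two values swapped.
interval : ℕ → List ℕ
interval n = map suc (downFrom n)

interval-↭ : ∀ n → map suc (upTo n) ↭ interval n
interval-↭ n = ↭-map⁺ suc
  (subst (_↭ downFrom n) (reverse-downFrom n) (↭-reverse (downFrom n)))

layered⇒↭ : ∀ {m π} → Layered ready m π → π ↭ interval m
layered⇒↭ []                = ↭-refl
layered⇒↭ (single l)        = prep _ (layered⇒↭ l)
layered⇒↭ (lower (upper l)) = swap _ _ (layered⇒↭ l)

layered-bounded : ∀ {m π} → Layered ready m π → ∀ i → lookup π i ≤ m
layered-bounded (single l)        zero          = ≤-refl
layered-bounded (single l)        (suc i)       = m≤n⇒m≤1+n (layered-bounded l i)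
layered-bounded (lower (upper l)) zero          = n≤1+n _
layered-bounded (lower (upper l)) (suc zero)    = ≤-refl
layered-bounded (lower (upper l)) (suc (suc i)) =
  m≤n⇒m≤1+n (m≤n⇒m≤1+n (layered-bounded l i))

-- The three patterns are those of length 3 whose first entry is below the last.
Gap : List ℕ → Set
Gap π = ∀ {i j k : Fin (length π)} → i Fin.< j → j Fin.< k → lookup π k < lookup π i

gap-tail : ∀ {a π} → Gap (a ∷ π) → Gap π
gap-tail gap i<j j<k = gap (s<s i<j) (s<s j<k)

-- Layers have at most two entries, so two positions with another between them lie in different
-- layers, and later layers are smaller.
layered⇒gap : ∀ {m π} → Layered ready m π → Gap π
layered⇒gap (single l) {zero} {suc j} {suc k} _ _ = s≤s (layered-bounded l k)
layered⇒gap (single l) {suc i} {suc j} {suc k} (s≤s i<j) (s≤s j<k) =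
  layered⇒gap l i<j j<k
layered⇒gap (lower (upper l)) {zero} {suc j} {suc (suc k)} _ _ =
  s≤s (layered-bounded l k)
layered⇒gap (lower (upper l)) {zero} {suc j} {suc zero} _ (s≤s ())
layered⇒gap (lower (upper l)) {suc zero} {suc (suc j)} {suc (suc k)} _ _ =
  m≤n⇒m≤1+n (s≤s (layered-bounded l k))
layered⇒gap (lower (upper l)) {suc zero} {suc zero} (s≤s ())
layered⇒gap (lower (upper l)) {suc zero} {suc (suc j)} {suc zero} _ (s≤s ())
layered⇒gap (lower (upper l)) {suc (suc i)} {suc (suc j)} {suc (suc k)}
  (s≤s (s≤s i<j)) (s≤s (s≤s j<k)) = layered⇒gap l i<j j<k
layered⇒gap (lower (upper l)) {suc (suc i)} {suc zero} (s≤s ())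
layered⇒gap (lower (upper l)) {suc (suc i)} {suc (suc j)} {suc zero} _ (s≤s ())

gap-∈ : ∀ {a b π x} → Gap (a ∷ b ∷ π) → x ∈ π → x < a
gap-∈ {a} gap x∈π =
  subst (_< a) (sym (lookup-index x∈π))
    (gap {zero} {suc zero} {suc (suc (Any.index x∈π))} z<s (s<s z<s))

∈-interval⁻ : ∀ {m x} → x ∈ interval m → x ≤ m
∈-interval⁻ x∈ with _ , y∈ , refl ← ∈-map⁻ suc x∈ = ∈-downFrom⁻ y∈

-- All entries from the third on are below the first, so the maximum stands first or second. If
-- first, it is a layer by itself.
gap⇒layered : ∀ m {π} → π ↭ interval m → Gap π → Layered ready m π
gap⇒layered zero    perm gap with refl ← ↭-empty-inv perm = []
gap⇒layered (suc m) perm gap with ∈-resp-↭ (↭-sym perm) (here refl)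
... | here refl = single (gap⇒layered m (drop-∷ perm) (gap-tail gap))
gap⇒layered (suc m) {a ∷ b ∷ π} perm gap | there (there m∈π) =
  contradiction (gap-∈ gap m∈π) (≤⇒≯ (∈-interval⁻ (∈-resp-↭ perm (here refl))))
gap⇒layered (suc m) {a ∷ b ∷ π} perm gap | there (here refl) =
  top-two m (drop-∷ (↭-trans (swap _ _ ↭-refl) perm))
  where
  -- With the maximum in second place, the next largest value must come first: in `π` it would lie
  -- below `a`, yet it bounds `a`.
  top-two : ∀ m → a ∷ π ↭ interval m → Layered ready (suc m) (a ∷ suc m ∷ π)
  top-two zero    perm′ with () ← ↭-empty-inv perm′
  top-two (suc m) perm′ with ∈-resp-↭ (↭-sym perm′) (here refl)
  ... | here refl = lower (upper (gap⇒layered m (drop-∷ perm′) (gap-tail (gap-tail gap))))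
  ... | there m∈π =
    contradiction (gap-∈ gap m∈π) (≤⇒≯ (∈-interval⁻ (∈-resp-↭ perm′ (here refl))))

gap⇒avoids : ∀ π x y z → x ≤ z → Gap π → π Avoids (x ∷ y ∷ z ∷ [])
gap⇒avoids π x y z x≤z gap (i , mono , order) =
  <⇒≱ (gap (mono {zero} {suc zero} z<s) (mono {suc zero} {suc (suc zero)} (s<s z<s)))
      (Equivalence.from (order zero (suc (suc zero))) x≤z)

SameOrder : ℕ → ℕ → ℕ → ℕ → Set
SameOrder u v x y = (u ≤ v ⇔ x ≤ y) × (v ≤ u ⇔ y ≤ x)

same-< : ∀ {u v x y} → u < v → x < y → SameOrder u v x y
same-< u<v x<y =
  mk⇔ (λ _ → <⇒≤ x<y) (λ _ → <⇒≤ u<v) ,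
  mk⇔ (λ v≤u → contradiction v≤u (<⇒≱ u<v)) (λ y≤x → contradiction y≤x (<⇒≱ x<y))

contains₃ : ∀ π {x y z} {i j k : Fin (length π)} → i Fin.< j → j Fin.< k →
            SameOrder (lookup π i) (lookup π j) x y →
            SameOrder (lookup π i) (lookup π k) x z →
            SameOrder (lookup π j) (lookup π k) y z →
            π Contains (x ∷ y ∷ z ∷ [])
contains₃ π {x} {y} {z} {i} {j} {k} i<j j<k ij ik jk =
  at , (λ {a} {b} → mono a b) , order
  where
  at : Fin 3 → Fin (length π)
  at zero             = i
  at (suc zero)       = j
  at (suc (suc zero)) = k

  mono : ∀ a b → a Fin.< b → at a Fin.< at b
  mono zero             (suc zero)       _ = i<j
  mono zero             (suc (suc zero)) _ = <-trans i<j j<k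
  mono (suc zero)       (suc (suc zero)) _ = j<k
  mono (suc zero)       (suc zero)       (s≤s ())
  mono (suc (suc zero)) (suc zero)       (s≤s ())
  mono (suc (suc zero)) (suc (suc zero)) (s≤s (s≤s ()))

  reflexive : ∀ {u v} → u ≤ u ⇔ v ≤ v
  reflexive = mk⇔ (λ _ → ≤-refl) (λ _ → ≤-refl)

  order : ∀ a b → lookup π (at a) ≤ lookup π (at b) ⇔
                  lookup (x ∷ y ∷ z ∷ []) a ≤ lookup (x ∷ y ∷ z ∷ []) b
  order zero             zero             = reflexive
  order zero             (suc zero)       = proj₁ ij
  order zero             (suc (suc zero)) = proj₁ ik
  order (suc zero)       zero             = proj₂ ij
  order (suc zero)       (suc zero)       = reflexive
  order (suc zero)       (suc (suc zero)) = proj₁ jk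
  order (suc (suc zero)) zero             = proj₂ ik
  order (suc (suc zero)) (suc zero)       = proj₂ jk
  order (suc (suc zero)) (suc (suc zero)) = reflexive

lookup-distinct : ∀ {xs : List ℕ} {i j : Fin (length xs)} → Unique xs → i Fin.< j →
                  lookup xs i ≢ lookup xs j
lookup-distinct {_ ∷ xs} {zero}  {suc j} (x∉ ∷ _) _         eq =
  All.lookup x∉ (∈-lookup j) eq
lookup-distinct {_ ∷ xs} {suc i} {suc j} (_ ∷ u)  (s≤s i<j) eq =
  lookup-distinct u i<j eq

patterns : List (List ℕ)
patterns = (1 ∷ 2 ∷ 3 ∷ []) ∷ (1 ∷ 3 ∷ 2 ∷ []) ∷ (2 ∷ 1 ∷ 3 ∷ []) ∷ []

1<2 : 1 < 2
1<2 = n<1+n 1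

2<3 : 2 < 3
2<3 = n<1+n 2

1<3 : 1 < 3
1<3 = <-trans 1<2 2<3

-- When π i < π k, the value of any entry between positions i and k decides which
-- of the three patterns occurs.
avoids⇒gap : ∀ {π} → Unique π → All (π Avoids_) patterns → Gap π
avoids⇒gap {π} u (no123 ∷ no132 ∷ no213 ∷ []) {i} {j} {k} i<j j<k
  with <-cmp (lookup π i) (lookup π k)
... | tri> _ _ k<i = k<i
... | tri≈ _ i≡k _ = contradiction i≡k (lookup-distinct u (<-trans i<j j<k))
... | tri< i<k _ _ with <-cmp (lookup π i) (lookup π j) | <-cmp (lookup π j) (lookup π k)
...   | tri≈ _ eq _ | _           = contradiction eq (lookup-distinct u i<j)
...   | _           | tri≈ _ eq _ = contradiction eq (lookup-distinct u j<k)
...   | tri< lt _ _ | tri< lt′ _ _ = ⊥-elim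
  (no123 (contains₃ π i<j j<k (same-< lt 1<2) (same-< i<k 1<3) (same-< lt′ 2<3)))
...   | tri< lt _ _ | tri> _ _ gt = ⊥-elim
  (no132 (contains₃ π i<j j<k (same-< lt 1<3) (same-< i<k 1<2) (×-swap (same-< gt 2<3))))
...   | tri> _ _ gt | tri< lt _ _ = ⊥-elim
  (no213 (contains₃ π i<j j<k (×-swap (same-< gt 1<2)) (same-< i<k 2<3) (same-< lt 1<3)))
...   | tri> _ _ gt | tri> _ _ gt′ = contradiction (<-trans gt′ gt) (<⇒≯ i<k)

permutation-unique : ∀ {n π} → IsPermutation n π → Unique π
permutation-unique {n} perm =
  Setoid↭.Unique-resp-↭ (setoid ℕ) (↭⇒↭ₛ (↭-sym perm))
    (Unique.map⁺ suc-injective (Unique.upTo⁺ n))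

-- Words as labelled Dyck paths.

path : ∀ {s h} → Word s h → List LabelledStep
path           end       = []
path {ready}   (level w) = N (suc (weight w)) ∷ E ∷ path w
path {pending} (level w) = N (suc (suc (weight w))) ∷ E ∷ path w
path           (down w)  = E ∷ path w
path           (up w)    = N (weight w) ∷ path w

-- The weight is the number of north steps left. A ready `level` takes the largest label left; `up`
-- takes the second largest and holds back the largest, which is one more than the weight of the
-- pending word and goes to its next `level`.
path-layered : ∀ {s h} (w : Word s h) → Layered s (weight w) (φ (path w))
path-layered           end       = []
path-layered {ready}   (level w) = single (path-layered w)
path-layered {pending} (level w) = upper (path-layered w)
path-layered           (down w)  = path-layered w
path-layered           (up w)    = lower (path-layered w)

E∷-linked : ∀ {p} → Linked Increasing p → Linked Increasing (E ∷ p)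
E∷-linked []      = [-]
E∷-linked [-]     = tt ∷ [-]
E∷-linked (r ∷ l) = tt ∷ r ∷ l

path-linked : ∀ {s h} (w : Word s h) → Linked Increasing (path w)
path-linked           end            = []
path-linked {ready}   (level w)      = tt ∷ E∷-linked (path-linked w)
path-linked {pending} (level w)      = tt ∷ E∷-linked (path-linked w)
path-linked           (down w)       = E∷-linked (path-linked w)
-- The only consecutive north steps: they carry the two labels of a layer, which differ by one.
path-linked           (up (level w)) = ≤-refl ∷ path-linked (level {pending} w)
path-linked           (up (down w))  = tt ∷ path-linked (down w)

#N-path : ∀ {s h} (w : Word s h) → #N (map forget (path w)) ≡ weight w
#N-path           end       = refl
#N-path {ready}   (level w) = cong suc (#N-path w)
#N-path {pending} (level w) = cong suc (#N-path w)
#N-path           (down w)  = #N-path w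
#N-path           (up w)    = cong suc (#N-path w)

-- The Dyck condition for the rest of a path, begun `h` above the diagonal and ending on it, in a
-- form suited to the recursion of `parse`.
data Ballot : ℕ → List LabelledStep → Set where
  []  : Ballot 0 []
  N∷_ : ∀ {h a p} → Ballot (suc h) p → Ballot h (N a ∷ p)
  E∷_ : ∀ {h p} → Ballot h p → Ballot (suc h) (E ∷ p)

path-ballot : ∀ {s h} (w : Word s h) → Ballot h (path w)
path-ballot           end       = []
path-ballot {ready}   (level w) = N∷ E∷ path-ballot w
path-ballot {pending} (level w) = N∷ E∷ path-ballot w
path-ballot           (down w)  = E∷ path-ballot w
path-ballot           (up w)    = N∷ path-ballot w

ballot-never-below : ∀ {h p} → Ballot h p → ∀ i →
  #E (take i (map forget p)) ≤ h + #N (take i (map forget p))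
ballot-never-below _      zero    = z≤n
ballot-never-below []     (suc i) = z≤n
ballot-never-below {h} (N∷ b) (suc i) =
  ≤-trans (ballot-never-below b i) (≤-reflexive (sym (+-suc h _)))
ballot-never-below (E∷ b) (suc i) = s≤s (ballot-never-below b i)

ballot-total : ∀ {h p} → Ballot h p → #E (map forget p) ≡ h + #N (map forget p)
ballot-total []         = refl
ballot-total {h} (N∷ b) = trans (ballot-total b) (sym (+-suc h _))
ballot-total (E∷ b)     = cong suc (ballot-total b)

ballot : ∀ {h} p → (∀ i → #E (take i (map forget p)) ≤ h + #N (take i (map forget p))) →
         #E (map forget p) ≡ h + #N (map forget p) → Ballot h p
ballot {zero}  []        above total = []
ballot {suc h} []        above ()
ballot {h}     (N a ∷ p) above total =
  N∷ ballot p (λ i → ≤-trans (above (suc i)) (≤-reflexive (+-suc h _)))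
              (trans total (+-suc h _))
ballot {suc h} (E ∷ p)   above total =
  E∷ ballot p (λ i → ≤-pred (above (suc i))) (suc-injective total)
-- An east step from the diagonal goes below it after one step.
ballot {zero}  (E ∷ p)   above total with () ← above 1

-- A label read by `single` or `upper` exceeds all later ones, so no north step can follow it
-- directly and the two steps N E form a `level`. A label read by `lower` is an `up`, whatever step
-- comes next.
parse : ∀ {s h m p} → Ballot h p → Linked Increasing p → Layered s m (φ p) →
        ∃[ w ] weight {s} {h} w ≡ m × path w ≡ p
parse []          _       []         = end , refl , refl
parse (E∷ b)      lk      l          with w , refl , refl ← parse b (Linked.tail lk) l =
  down w , refl , refl
parse (N∷ b)      lk      (lower l)  with w , refl , refl ← parse b (Linked.tail lk) l =
  up w , refl , refl
parse (N∷ E∷ b)   lk      (single l)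
  with w , refl , refl ← parse b (Linked.tail (Linked.tail lk)) l = level w , refl , refl
parse (N∷ E∷ b)   lk      (upper l)
  with w , refl , refl ← parse b (Linked.tail (Linked.tail lk)) l = level w , refl , refl
parse (N∷ (N∷ b)) (r ∷ _) (single l) =
  contradiction (m≤n⇒m≤1+n (layered-bounded l zero)) (<⇒≱ r)
parse (N∷ (N∷ b)) (r ∷ _) (upper l)  =
  contradiction (m≤n⇒m≤1+n (m≤n⇒m≤1+n (layered-bounded l zero))) (<⇒≱ r)

weight-determined : ∀ {s h s′ h′} {v : Word s h} {w : Word s′ h′} →
                    path v ≡ path w → weight v ≡ weight w
weight-determined {v = v} {w} eq =
  trans (sym (#N-path v)) (trans (cong (#N ∘ map forget) eq) (#N-path w))

N-injective : ∀ {a b} → LabelledStep.N a ≡ N b → a ≡ b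
N-injective refl = refl

-- A level and an up step with the same weight carry different labels.
level≢up : ∀ {h} (v : Word ready h) (w : Word pending (suc h)) →
           path (level {ready} v) ≢ path (up w)
level≢up v w eq = 1+n≢n
  (trans (N-injective (∷-injectiveˡ eq))
    (sym (suc-injective (weight-determined {v = level {ready} v} {up w} eq))))

path-injective : ∀ {s h} {v w : Word s h} → path v ≡ path w → v ≡ w
path-injective {v = end}    {end}    eq = refl
path-injective {ready}   {v = level v} {level w} eq =
  cong level (path-injective (∷-injectiveʳ (∷-injectiveʳ eq)))
path-injective {pending} {v = level v} {level w} eq =
  cong level (path-injective (∷-injectiveʳ (∷-injectiveʳ eq)))
path-injective {v = down v}  {down w}  eq = cong down (path-injective (∷-injectiveʳ eq))
path-injective {v = up v}    {up w}    eq = cong up (path-injective (∷-injectiveʳ eq))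
path-injective {v = level v} {up w}    eq = ⊥-elim (level≢up v w eq)
path-injective {v = up v}    {level w} eq = ⊥-elim (level≢up w v (sym eq))
path-injective {ready}   {v = level v} {down w} ()
path-injective {pending} {v = level v} {down w} ()
path-injective {ready}   {v = down v} {level w} ()
path-injective {pending} {v = down v} {level w} ()

parking-cardinality : ∀ n → IsPf n patterns (length (words ready 0 n))
parking-cardinality n = transfer path path-injective sound covers
  (words-cardinality ready 0 n)
  where
  sound : ∀ {w : Word ready 0} → weight w ≡ n →
          IsParkingFunction n (path w) × All (φ (path w) Avoids_) patterns
  sound {w} refl = record
    { dyck = record
        { north-steps = #N-path w
        ; east-steps  = trans (ballot-total (path-ballot w)) (#N-path w)
        ; never-below = ballot-never-below (path-ballot w)
        }
    ; bijective  = ↭-trans (layered⇒↭ (path-layered w)) (↭-sym (interval-↭ n))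
    ; increasing = path-linked w
    } , gap⇒avoids π 1 2 3 (s≤s z≤n) gap
      ∷ gap⇒avoids π 1 3 2 (s≤s z≤n) gap
      ∷ gap⇒avoids π 2 1 3 (s≤s (s≤s z≤n)) gap ∷ []
    where
    π = φ (path w)

    gap : Gap π
    gap = layered⇒gap (path-layered w)

  covers : ∀ {p} → IsParkingFunction n p × All (φ p Avoids_) patterns →
           ∃[ w ] weight {ready} {0} w ≡ n × path w ≡ p
  covers {p} (parking , avoids) =
    parse (ballot p never-below (trans east-steps (sym north-steps))) increasing
      (gap⇒layered n (↭-trans bijective (interval-↭ n))
        (avoids⇒gap (permutation-unique bijective) avoids))
    where
    open IsParkingFunction parking
    open IsDyckPath dyck

theorem11 : ∀ (n : ℕ) → n ≥ 1 →
    ∃[ k ]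
    IsPf n ((1 ∷ 2 ∷ 3 ∷ []) ∷ (1 ∷ 3 ∷ 2 ∷ []) ∷ (2 ∷ 1 ∷ 3 ∷ []) ∷ []) k
    × HasCardinality (λ t → (edges t ≡ n + 1) × EveryVertexLeafOrAdjacentToLeaf t) k
theorem11 n _ = length (words ready 0 n) , parking-cardinality n , trees-cardinality n
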